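{- Let $A$ be a ring whose additive group $(A,+,\le)$ is totally ordered, let $b,d\in A$ with $0<d$, and set $B=\{b+id: i\in\mathbb{Z}_{\ge0}\}$. Let $k\ge1$ be an integer and let $c_1,\dots,c_{k+1}\in B$ with $b<c_1<\cdots<c_{k+1}$. Put $C=\{c_1,\dots,c_{k+1}\}$ and $D_i=C\setminus\{c_i\}$ for each $i\in\{1,\dots,k+1\}$. Suppose that the following conditions hold: (1) $c_i$ has a decomposition in $B\setminus C$ for each $i\in\{1,\dots,k+1\}$; (2) $b+c_{k+1}=c_{i_0}+c_{j_0}$ for some integers $i_0,j_0\le k$ (indices in $\{1,\dots,k\}$) with $i_0\ne j_0$; (3) $B\gtrdot\Rightarrow_2 B\setminus D_i$ for each $i\in\{1,\dots,k+1\}$. Then $B\gtrdot\Rightarrow_2 B\setminus\{c_1,\dots,c_{k+1}\}$, that is, $\{c_1,\dots,c_{k+1}\}$ is a 2-th sum-factor collapsed subset of $B$.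
   Context: The additive group $(A,+,\le)$ is totally ordered means that $\le$ is a total order on $A$ such that $v_1\le v_2$ implies $v_1+w\le v_2+w$ for all $v_1,v_2,w\in A$; $v<w$ means $v\le w$ and $v\ne w$. Rings are associative and need not be commutative or contain $1$. Here $id$ with $i\in\mathbb{Z}_{\ge0}$ is the $i$-fold sum $d+\cdots+d$. An element $a\in A$ has a decomposition in a subset $S\subset A$ if $a=s_1\cdots s_m$ for some $m\ge1$ and $s_1,\dots,s_m\in S$. For non-empty $S\subset A$, $2S=\{s+s': s,s'\in S\}$. For non-empty subsets $S,T\subset A$, write $S\gtrdot\Rightarrow_2 T$ if $S\supset T$, $2S=2T$, and every $s\in S$ can be written as $s=t_1\cdots t_m$ with $m\ge1$ and $t_1,\dots,t_m\in T$. A subset $C\subset B$ is a 2-th sum-factor collapsed subset of $B$ if $B\setminus C$ is non-empty and $B\gtrdot\Rightarrow_2 B\setminus C$. -}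

module Defs where

open import Algebra.Bundles using (Group; RingWithoutOne)
import Algebra.Definitions.RawMonoid as RawMonoidDefinitions
open import Data.List.NonEmpty using (List⁺; foldr₁)
open import Data.List.NonEmpty.Relation.Unary.All using (All)
open import Data.Nat.Base using (ℕ)
open import Data.Product.Base using (_×_; ∃; ∃₂)
open import Level using (Level; suc; _⊔_)
open import Relation.Binary.Core using (Rel)
import Relation.Binary.Construct.NonStrictToStrict as NonStrictToStrict
open import Relation.Binary.Structures using (IsTotalOrder)
open import Relation.Unary using (Pred; _∈_; _⊆_; _⊇_; _≐_; _∖_; Satisfiable)

record AdditivelyOrderedRing (a ℓ₁ ℓ₂ : Level) : Set (suc (a ⊔ ℓ₁ ⊔ ℓ₂)) where
  field
    ringWithoutOne : RingWithoutOne a ℓ₁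

  open RingWithoutOne ringWithoutOne public

  infix 4 _≤_
  field
    _≤_          : Rel Carrier ℓ₂
    isTotalOrder : IsTotalOrder _≈_ _≤_
    +-monoˡ-≤    : ∀ w {v₁ v₂} → v₁ ≤ v₂ → v₁ + w ≤ v₂ + w

  open NonStrictToStrict _≈_ _≤_ public using (_<_)

  open RawMonoidDefinitions (Group.rawMonoid +-group) public
    using () renaming (_×_ to infixr 8 _·_)

-- Subsets of the ring are predicates.  Equality of elements is _≈_, so the
-- set-builder definitions below are closed under _≈_ by construction.

module _ {a ℓ₁ ℓ₂ : Level} (A : AdditivelyOrderedRing a ℓ₁ ℓ₂) where
  open AdditivelyOrderedRing A

  private variable
    p q : Level

  Progression : Carrier → Carrier → Pred Carrier ℓ₁
  Progression b d x = ∃ λ (i : ℕ) → x ≈ b + i · d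

  Range : ∀ {i} {I : Set i} → (I → Carrier) → Pred Carrier (i ⊔ ℓ₁)
  Range c x = ∃ λ i → x ≈ c i

  Doubling : Pred Carrier p → Pred Carrier (a ⊔ ℓ₁ ⊔ p)
  Doubling S x = ∃₂ λ s s′ → s ∈ S × s′ ∈ S × x ≈ s + s′

  HasDecomposition : Pred Carrier p → Pred Carrier (a ⊔ ℓ₁ ⊔ p)
  HasDecomposition S x = ∃ λ (ss : List⁺ Carrier) → All S ss × x ≈ foldr₁ _*_ ss

  record CollapsesTo₂ (S : Pred Carrier p) (T : Pred Carrier q)
                      : Set (a ⊔ ℓ₁ ⊔ p ⊔ q) where
    field
      nonEmptyˡ  : Satisfiable S
      nonEmptyʳ  : Satisfiable T
      superset   : S ⊇ T
      sameDouble : Doubling S ≐ Doubling T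
      decomposes : ∀ {s} → s ∈ S → HasDecomposition T s

  record IsSumFactorCollapsed₂ (B : Pred Carrier p) (C : Pred Carrier q)
                               : Set (a ⊔ ℓ₁ ⊔ p ⊔ q) where
    field
      subset    : C ⊆ B
      nonEmpty  : Satisfiable (B ∖ C)
      collapses : CollapsesTo₂ B (B ∖ C)

-- Writing an element of 2B as b + (b + nd) and c_{k+1} = b + md, compare n with m.
-- If n > m, then b + (b + nd) itself avoids C.  If n = m, the splitting b + c_{k+1} = c_{i₀} + c_{j₀}
-- shows that a sum avoiding D_{i₀} cannot have the summand c_{i₀}, since the other summand would be
-- c_{j₀} ∈ D_{i₀}.  If n < m, a sum avoiding D_{k+1} cannot have the summand c_{k+1}, which is too large.

{-# OPTIONS --safe #-}
module Submission where

open import Defs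
open import Data.Fin.Base using (Fin; inject₁; fromℕ) renaming (zero to fzero; _<_ to _<ᶠ_)
open import Data.Nat.Base using (ℕ; suc) renaming (_≤_ to _≤ⁿ_)
open import Data.Product.Base using (_×_; ∃₂)
open import Level using (Level)
open import Relation.Binary.Core using (_Preserves_⟶_)
open import Relation.Binary.PropositionalEquality.Core using (_≢_)
open import Relation.Unary using (Pred; _∈_; _∖_)

open import Algebra.Bundles using (AbelianGroup; Group)
import Algebra.Properties.CommutativeSemigroup as CommutativeSemigroupProperties
import Algebra.Properties.Group as GroupProperties
import Algebra.Properties.Monoid.Mult as MonoidMult
open import Data.Fin.Base using () renaming (_≤_ to _≤ᶠ_)
import Data.Fin.Properties as Fin
open import Data.List.NonEmpty using ([_])
open import Data.List.NonEmpty.Relation.Unary.All using (_∷_)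
open import Data.List.Relation.Unary.All using ([])
open import Data.Nat.Base using (zero; z≤n; s≤s) renaming (_+_ to _+ⁿ_; _<_ to _<ⁿ_)
import Data.Nat.Properties as ℕ
open import Data.Product.Base using (_,_; proj₁; proj₂)
open import Function.Base using (_∘_)
open import Relation.Binary.Bundles using (Poset)
open import Relation.Binary.Definitions using (tri<; tri≈; tri>)
open import Relation.Binary.PropositionalEquality.Core using (_≡_; refl)
import Relation.Binary.Properties.Poset as PosetProperties
import Relation.Binary.Reasoning.PartialOrder as PartialOrderReasoning
import Relation.Binary.Reasoning.Setoid as SetoidReasoning
open import Relation.Binary.Structures using (IsTotalOrder)
open import Relation.Nullary.Decidable using (Dec; yes; no; map′)
open import Relation.Nullary.Negation using (¬_; contradiction)
open import Relation.Unary using (_∉_; _⊆_)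

module _ {a ℓ₁ ℓ₂ : Level} (A : AdditivelyOrderedRing a ℓ₁ ℓ₂) where
  open AdditivelyOrderedRing A renaming (refl to ≈-refl)

  private
    poset : Poset a ℓ₁ ℓ₂
    poset = record { isPartialOrder = IsTotalOrder.isPartialOrder isTotalOrder }

    module ≈-Reasoning = SetoidReasoning setoid
    module ≤-Reasoning = PartialOrderReasoning poset

  open Poset poset using () renaming (reflexive to ≤-reflexive)
  open PosetProperties poset using (<⇒≉; <⇒≱)
  open GroupProperties +-group using (∙-cancelˡ)
  open MonoidMult (Group.monoid +-group) using (×-homo-+)
  open CommutativeSemigroupProperties (AbelianGroup.commutativeSemigroup +-abelianGroup)
    using (interchange)

  private variable
    b d v w x y : Carrier
    n : ℕ

  +-monoʳ-≤ : ∀ x → v ≤ w → x + v ≤ x + w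
  +-monoʳ-≤ {v} {w} x v≤w = begin
    x + v  ≈⟨ +-comm x v ⟩
    v + x  ≤⟨ +-monoˡ-≤ x v≤w ⟩
    w + x  ≈⟨ +-comm w x ⟩
    x + w  ∎
    where open ≤-Reasoning

  -- Strictness survives because addition in a group cancels.
  +-monoʳ-< : ∀ x → v < w → x + v < x + w
  +-monoʳ-< x (v≤w , v≉w) = +-monoʳ-≤ x v≤w , v≉w ∘ ∙-cancelˡ x _ _

  0≤i·d : 0# ≤ d → ∀ i → 0# ≤ i · d
  0≤i·d 0≤d zero = ≤-reflexive ≈-refl
  0≤i·d {d} 0≤d (suc i) = begin
    0#         ≤⟨ 0≤d ⟩
    d          ≈⟨ +-identityʳ d ⟨
    d + 0#     ≤⟨ +-monoʳ-≤ d (0≤i·d 0≤d i) ⟩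
    d + i · d  ∎
    where open ≤-Reasoning

  ·-monoˡ-< : 0# < d → ∀ {i j} → i <ⁿ j → i · d < j · d
  -- A positive index contributes at least one copy of `d`, and the remaining copies add something
  -- non-negative.
  ·-monoˡ-< {d} 0<d {zero} {suc j} _ = begin-strict
    0#         <⟨ 0<d ⟩
    d          ≈⟨ +-identityʳ d ⟨
    d + 0#     ≤⟨ +-monoʳ-≤ d (0≤i·d (proj₁ 0<d) j) ⟩
    d + j · d  ∎
    where open ≤-Reasoning
  ·-monoˡ-< {d} 0<d {suc i} {suc j} (s≤s i<j) = +-monoʳ-< d (·-monoˡ-< 0<d i<j)

  ·-injectiveˡ : 0# < d → ∀ i j → i · d ≈ j · d → i ≡ j
  ·-injectiveˡ 0<d i j i·d≈j·d with ℕ.<-cmp i j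
  ... | tri< i<j _ _ = contradiction i·d≈j·d (<⇒≉ (·-monoˡ-< 0<d i<j))
  ... | tri≈ _ i≡j _ = i≡j
  ... | tri> _ _ j<i = contradiction (sym i·d≈j·d) (<⇒≉ (·-monoˡ-< 0<d j<i))

  base∈Progression : ∀ b d → b ∈ Progression A b d
  base∈Progression b d = 0 , sym (+-identityʳ b)

  base≤Progression : 0# ≤ d → x ∈ Progression A b d → b ≤ x
  base≤Progression {d} {x} {b} 0≤d (i , x≈) = begin
    b          ≈⟨ +-identityʳ b ⟨
    b + 0#     ≤⟨ +-monoʳ-≤ b (0≤i·d 0≤d i) ⟩
    b + i · d  ≈⟨ x≈ ⟨
    x          ∎
    where open ≤-Reasoning

  -- Equality on the whole ring is not assumed decidable. Since `0# < d`, distinct indices give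
  -- distinct elements, so equality inside the progression reduces to equality of indices. This
  -- makes it decidable whether an element of `B` lies in the finite family `c`.
  Progression-≈? : 0# < d → x ∈ Progression A b d → y ∈ Progression A b d → Dec (x ≈ y)
  Progression-≈? {d} {x} {b} {y} 0<d (i , x≈) (j , y≈) = map′ to from (i ℕ.≟ j)
    where
    to : i ≡ j → x ≈ y
    to refl = trans x≈ (sym y≈)
    from : x ≈ y → i ≡ j
    from x≈y = ·-injectiveˡ 0<d i j (∙-cancelˡ b _ _ (trans (sym x≈) (trans x≈y y≈)))

  -- Brings each element of 2B to a form governed by a single natural number, so that the later case
  -- distinction takes place in `ℕ`.
  Progression-sum : ∀ b d i j → (b + i · d) + (b + j · d) ≈ b + (b + (i +ⁿ j) · d)
  Progression-sum b d i j = begin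
    (b + i · d) + (b + j · d)  ≈⟨ interchange b (i · d) b (j · d) ⟩
    (b + b) + (i · d + j · d)  ≈⟨ +-congˡ (×-homo-+ d i j) ⟨
    (b + b) + (i +ⁿ j) · d     ≈⟨ +-assoc b b _ ⟩
    b + (b + (i +ⁿ j) · d)     ∎
    where open ≈-Reasoning

  Preserves-<⇒≤ : (c : Fin n → Carrier) → c Preserves _<ᶠ_ ⟶ _<_ → c Preserves _≤ᶠ_ ⟶ _≤_
  Preserves-<⇒≤ c mono {i} {j} i≤j with i Fin.≟ j
  ... | yes refl = ≤-reflexive ≈-refl
  ... | no  i≢j  = proj₁ (mono (Fin.≤∧≢⇒< i≤j i≢j))

  Preserves-<⇒injective : (c : Fin n → Carrier) → c Preserves _<ᶠ_ ⟶ _<_ →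
                          ∀ {i j} → c i ≈ c j → i ≡ j
  Preserves-<⇒injective c mono {i} {j} ci≈cj with Fin.<-cmp i j
  ... | tri< i<j _ _ = contradiction ci≈cj (<⇒≉ (mono i<j))
  ... | tri≈ _ i≡j _ = i≡j
  ... | tri> _ _ j<i = contradiction (sym ci≈cj) (<⇒≉ (mono j<i))

  Doubling-mono : ∀ {p q} {S : Pred Carrier p} {T : Pred Carrier q} →
                  S ⊆ T → Doubling A S ⊆ Doubling A T
  Doubling-mono S⊆T (s , s′ , s∈S , s′∈S , x≈) = s , s′ , S⊆T s∈S , S⊆T s′∈S , x≈

  -- Both summands already avoid every element of `C` other than `e`, so only `e` itself remains to
  -- be excluded. By commutativity of addition it is enough to exclude it as the first summand.
  Doubling-avoids :
    ∀ {p q} {B : Pred Carrier p} {C : Pred Carrier q} {x e : Carrier} →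
    x ∈ Doubling A (B ∖ (C ∖ (_≈ e))) →
    (∀ {u v} → v ∈ B ∖ (C ∖ (_≈ e)) → x ≈ u + v → ¬ u ≈ e) →
    x ∈ Doubling A (B ∖ C)
  Doubling-avoids (u , v , u∈ , v∈ , x≈) avoids =
    u , v ,
    (proj₁ u∈ , λ u∈C → proj₂ u∈ (u∈C , avoids v∈ x≈)) ,
    (proj₁ v∈ , λ v∈C → proj₂ v∈ (v∈C , avoids u∈ (trans x≈ (+-comm u v)))) ,
    x≈

  module _ {b d : Carrier} (0<d : 0# < d) {k : ℕ} (c : Fin (suc k) → Carrier)
           (c∈B : ∀ i → c i ∈ Progression A b d)
           (b<c₀ : b < c fzero)
           (c-mono : c Preserves _<ᶠ_ ⟶ _<_)
           where

    private
      B : Pred Carrier ℓ₁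
      B = Progression A b d

      C : Pred Carrier ℓ₁
      C = Range A c

      -- Deletion is by value rather than by index; as `c` is injective, `c j` stays in `D i`
      -- whenever `j ≢ i`.
      D : Fin (suc k) → Pred Carrier ℓ₁
      D i = C ∖ (_≈ c i)

    below-Range : x < c fzero → x ∉ C
    below-Range {x} x<c₀ (i , x≈ci) = <⇒≱ x<c₀ (begin
      c fzero  ≤⟨ Preserves-<⇒≤ c c-mono z≤n ⟩
      c i      ≈⟨ x≈ci ⟨
      x        ∎)
      where open ≤-Reasoning

    above-Range : c (fromℕ k) < x → x ∉ C
    above-Range {x} cₖ<x (i , x≈ci) = <⇒≱ cₖ<x (begin
      x            ≈⟨ x≈ci ⟩
      c i          ≤⟨ Preserves-<⇒≤ c c-mono (Fin.≤fromℕ i) ⟩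
      c (fromℕ k)  ∎)
      where open ≤-Reasoning

    -- Serves both to show that the complement is non-empty and as a summand for the elements of 2B
    -- beyond `b + c (fromℕ k)`.
    base∈B∖C : b ∈ B ∖ C
    base∈B∖C = base∈Progression b d , below-Range b<c₀

    -- An element outside `C` is a product with one factor, itself; an element of `C` inherits the
    -- decomposition of the `c i` it equals.
    B∖C-decomposes : (∀ i → HasDecomposition A (B ∖ C) (c i)) →
                     x ∈ B → HasDecomposition A (B ∖ C) x
    B∖C-decomposes {x} c-decomposes x∈B
      with Fin.any? (λ i → Progression-≈? 0<d x∈B (c∈B i))
    ... | no  x∉C         = [ x ] , (x∈B , x∉C) ∷ [] , ≈-refl
    ... | yes (i , x≈ci) with ss , ss∈ , ci≈ ← c-decomposes i = ss , ss∈ , trans x≈ci ci≈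

    Doubling-B⊆Doubling-B∖C :
      ∀ {i₀ j₀} → i₀ ≢ j₀ → b + c (fromℕ k) ≈ c i₀ + c j₀ →
      (∀ i → Doubling A B ⊆ Doubling A (B ∖ D i)) →
      Doubling A B ⊆ Doubling A (B ∖ C)
    Doubling-B⊆Doubling-B∖C {i₀} {j₀} i₀≢j₀ split 2B⊆ {x} x∈2B@(s , s′ , (p , s≈) , (q , s′≈) , x≈s+s′)
      with m , cₖ≈ ← c∈B (fromℕ k) = by-cases (ℕ.<-cmp (p +ⁿ q) m)
      where
      n′ : ℕ
      n′ = p +ⁿ q

      x≈ : x ≈ b + (b + n′ · d)
      x≈ = trans x≈s+s′ (trans (+-cong s≈ s′≈) (Progression-sum b d p q))

      by-cases : _ → x ∈ Doubling A (B ∖ C)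
      -- If `u ≈ c (fromℕ k)`, then `b ≤ v` forces `b + c (fromℕ k) ≤ x`, against `n′ < m`.
      by-cases (tri< n<m _ _) = Doubling-avoids (2B⊆ (fromℕ k) x∈2B) λ {u} {v} v∈ x≈u+v u≈cₖ →
        <⇒≱ (+-monoʳ-< b (+-monoʳ-< b (·-monoˡ-< 0<d n<m))) (begin
          b + (b + m · d)   ≈⟨ +-congˡ cₖ≈ ⟨
          b + c (fromℕ k)   ≤⟨ +-monoˡ-≤ _ (base≤Progression (proj₁ 0<d) (proj₁ v∈)) ⟩
          v + c (fromℕ k)   ≈⟨ +-congˡ u≈cₖ ⟨
          v + u             ≈⟨ +-comm v u ⟩
          u + v             ≈⟨ x≈u+v ⟨
          x                 ≈⟨ x≈ ⟩
          b + (b + n′ · d)  ∎)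
        where open ≤-Reasoning
      -- Now `x ≈ b + c (fromℕ k)`, so `split` applies to `x`, and cancelling `c i₀` determines the
      -- other summand.
      by-cases (tri≈ _ refl _) = Doubling-avoids (2B⊆ i₀ x∈2B) λ {u} {v} v∈ x≈u+v u≈ci₀ →
        let v≈cj₀ = ∙-cancelˡ (c i₀) v (c j₀) (begin
              c i₀ + v         ≈⟨ +-congʳ u≈ci₀ ⟨
              u + v            ≈⟨ x≈u+v ⟨
              x                ≈⟨ x≈ ⟩
              b + (b + m · d)  ≈⟨ +-congˡ cₖ≈ ⟨
              b + c (fromℕ k)  ≈⟨ split ⟩
              c i₀ + c j₀      ∎)
        -- Since `i₀ ≢ j₀`, the value `c j₀` differs from `c i₀`; hence `v` lies in `D i₀`, which it
        -- was supposed to avoid.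
        in proj₂ v∈ ((j₀ , v≈cj₀) , λ v≈ci₀ →
             i₀≢j₀ (Preserves-<⇒injective c c-mono (trans (sym v≈ci₀) v≈cj₀)))
        where open ≈-Reasoning
      -- The first summand lies below all of `C` and the second above all of it.
      by-cases (tri> _ _ m<n) = b , b + n′ · d , base∈B∖C , ((n′ , ≈-refl) , above-Range cₖ<) , x≈
        where
        open ≤-Reasoning
        cₖ< : c (fromℕ k) < b + n′ · d
        cₖ< = begin-strict
          c (fromℕ k)  ≈⟨ cₖ≈ ⟩
          b + m · d    <⟨ +-monoʳ-< b (·-monoˡ-< 0<d m<n) ⟩
          b + n′ · d   ∎

theorem2p15 :
  ∀ {a ℓ₁ ℓ₂ : Level} (A : AdditivelyOrderedRing a ℓ₁ ℓ₂) →
  let open AdditivelyOrderedRing A in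
  (b d : Carrier) → 0# < d →
  let B : Pred Carrier ℓ₁
      B = Progression A b d
  in
  (k : ℕ) → 1 ≤ⁿ k →
  (c : Fin (suc k) → Carrier) →
  (∀ i → c i ∈ B) →
  b < c fzero →
  c Preserves _<ᶠ_ ⟶ _<_ →
  let C : Pred Carrier ℓ₁
      C = Range A c
      D : Fin (suc k) → Pred Carrier ℓ₁
      D i = C ∖ (_≈ c i)
  in
  (∀ i → HasDecomposition A (B ∖ C) (c i)) →
  (∃₂ λ (i₀ j₀ : Fin k) →
     i₀ ≢ j₀ × b + c (fromℕ k) ≈ c (inject₁ i₀) + c (inject₁ j₀)) →
  (∀ i → CollapsesTo₂ A B (B ∖ D i)) →
  CollapsesTo₂ A B (B ∖ C) × IsSumFactorCollapsed₂ A B C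
theorem2p15 A b d 0<d k _ c c∈B b<c₀ c-mono c-decomposes (i₀ , j₀ , i₀≢j₀ , split) collapses =
  B⇒B∖C , record { subset = C⊆B ; nonEmpty = b , b∈B∖C ; collapses = B⇒B∖C }
  where
  open AdditivelyOrderedRing A using (trans)

  b∈B∖C : b ∈ Progression A b d ∖ Range A c
  b∈B∖C = base∈B∖C A 0<d c c∈B b<c₀ c-mono

  C⊆B : Range A c ⊆ Progression A b d
  C⊆B (i , x≈ci) with n , ci≈ ← c∈B i = n , trans x≈ci ci≈

  B⇒B∖C : CollapsesTo₂ A (Progression A b d) (Progression A b d ∖ Range A c)
  B⇒B∖C = record
    { nonEmptyˡ  = b , proj₁ b∈B∖C
    ; nonEmptyʳ  = b , b∈B∖C
    ; superset   = proj₁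
    ; sameDouble =
        -- The indices of condition (2) live in `Fin k`; injectivity of `inject₁` keeps them
        -- distinct in `Fin (suc k)`.
        Doubling-B⊆Doubling-B∖C A 0<d c c∈B b<c₀ c-mono (i₀≢j₀ ∘ Fin.inject₁-injective) split
          (λ i → proj₁ (CollapsesTo₂.sameDouble (collapses i)))
      , Doubling-mono A proj₁
    ; decomposes = B∖C-decomposes A 0<d c c∈B b<c₀ c-mono c-decomposes
    }
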